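{- If $n$ is a non-negative integer and $p$ and $q$ are non-zero integers, then $$\sum_{k=0}^n(-1)^{(p-q)(n-k)}\frac{n}{n+k}\binom{n+k}{n-k}\left(\frac{F_{p+q}F_{p-q}}{F_pF_q}\right)^{2k}=\frac{F_p^{4n}+F_q^{4n}}{2F_q^{2n}F_p^{2n}}.$$
   Context: $F_n$ ($n\in\mathbb{Z}$) are the Fibonacci numbers: $F_0=0$, $F_1=1$, $F_n=F_{n-1}+F_{n-2}$, extended to negative indices by $F_{ -n}=(-1)^{n-1}F_n$. The coefficient $\frac{n}{n+k}\binom{n+k}{n-k}$ equals $\binom{n+k-1}{k}\binom{n}{k}/\binom{2k}{k}$; for $n=k=0$ it is understood to be $1$. The convention $0^0=1$ is used. -}

module Defs where

open import Data.Nat.Base as ℕ using (ℕ; zero; suc)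
import Data.Nat.Properties as ℕ
open import Data.Nat.Combinatorics using (_C_)
open import Data.Integer.Base as ℤ using (ℤ; +_; -[1+_]; +[1+_]; -1ℤ)
import Data.Integer.Properties as ℤ
open import Data.Rational.Base as ℚ using (ℚ; mkℚ; 1ℚ; 0ℚ; _/_; _*_; 1/_)
import Data.Rational.Properties as ℚ
open import Data.Fin.Base using (toℕ)
open import Algebra.Definitions.RawSemiring ℚ.+-*-rawSemiring using (sum)
open import Algebra.Definitions.RawSemiring ℚ.+-*-rawSemiring public using (_^_)
open import Function.Base using (it)
open import Relation.Binary.PropositionalEquality
  using (_≡_; _≢_; refl; cong; module ≡-Reasoning)

fib : ℕ → ℕ
fib 0 = 0
fib 1 = 1
fib (suc (suc n)) = fib (suc n) ℕ.+ fib n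

-- F₋ₘ = (-1)ᵐ⁻¹ Fₘ, where -[1+ n ] = -m with m = suc n.
F : ℤ → ℤ
F (+ n)    = + fib n
F -[1+ n ] = (-1ℤ ℤ.^ n) ℤ.* + fib (suc n)

fromℤ : ℤ → ℚ
fromℤ i = i / 1

Fℚ : ℤ → ℚ
Fℚ p = fromℤ (F p)

infixr 8 _^ℤ_
_^ℤ_ : (x : ℚ) → ℤ → .{{_ : ℚ.NonZero x}} → ℚ
x ^ℤ (+ n)    = x ^ n
x ^ℤ -[1+ n ] = (1/ x) ^ suc n

-- n/(n+k) · C(n+k, n-k), read as 1 at n = k = 0.  Only k ≤ n is used, so
-- truncated subtraction agrees with subtraction.
coeff : ℕ → ℕ → ℚ
coeff zero      zero      = 1ℚ
coeff n@zero    k@(suc _) = (+ n / (n ℕ.+ k)) * fromℤ (+ ((n ℕ.+ k) C (n ℕ.∸ k)))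
coeff n@(suc _) k         = (+ n / (n ℕ.+ k)) * fromℤ (+ ((n ℕ.+ k) C (n ℕ.∸ k)))

infixl 10 ∑≤-syntax
∑≤-syntax : ℕ → (ℕ → ℚ) → ℚ
∑≤-syntax n f = sum {suc n} (λ i → f (toℕ i))

syntax ∑≤-syntax n (λ k → e) = ∑[ k ≤ n ] e

nonZero⇒≢0 : ∀ x .{{_ : ℚ.NonZero x}} → x ≢ 0ℚ
nonZero⇒≢0 _ {{()}} refl

*-nonZero : ∀ x y .{{_ : ℚ.NonZero x}} .{{_ : ℚ.NonZero y}} → ℚ.NonZero (x * y)
*-nonZero x y = ℚ.≢-nonZero λ xy≡0 → nonZero⇒≢0 y (begin
  y               ≡⟨ ℚ.*-identityˡ y ⟨
  1ℚ * y          ≡⟨ cong (_* y) (ℚ.*-inverseˡ x) ⟨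
  (1/ x * x) * y  ≡⟨ ℚ.*-assoc (1/ x) x y ⟩
  1/ x * (x * y)  ≡⟨ cong (1/ x *_) xy≡0 ⟩
  1/ x * 0ℚ       ≡⟨ ℚ.*-zeroʳ (1/ x) ⟩
  0ℚ              ∎)
  where open ≡-Reasoning

^-nonZero : ∀ x n .{{_ : ℚ.NonZero x}} → ℚ.NonZero (x ^ n)
^-nonZero x zero    = _
^-nonZero x (suc n) = *-nonZero x (x ^ n) {{it}} {{^-nonZero x n}}

fromℤ-nonZero : ∀ i .{{_ : ℤ.NonZero i}} → ℚ.NonZero (fromℤ i)
fromℤ-nonZero +[1+ n ] = ℚ.pos⇒nonZero (+[1+ n ] / 1) {{ℚ.normalize-pos (suc n) 1}}
fromℤ-nonZero -[1+ n ] = neg (ℚ.normalize (suc n) 1) {{ℚ.pos⇒nonZero (ℚ.normalize (suc n) 1) {{ℚ.normalize-pos (suc n) 1}}}}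
  where
  neg : ∀ x .{{_ : ℚ.NonZero x}} → ℚ.NonZero (ℚ.- x)
  neg (mkℚ +[1+ _ ] _ _) = _
  neg (mkℚ -[1+ _ ] _ _) = _

fib-nonZero : ∀ n → ℕ.NonZero (fib (suc n))
fib-nonZero zero    = _
fib-nonZero (suc n) =
  ℕ.>-nonZero (ℕ.<-≤-trans (ℕ.>-nonZero⁻¹ _ {{fib-nonZero n}}) (ℕ.m≤m+n (fib (suc n)) (fib n)))

±1-nonZero : ∀ n → ℤ.NonZero (-1ℤ ℤ.^ n)
±1-nonZero zero    = _
±1-nonZero (suc n) = ℤ.i*j≢0 -1ℤ (-1ℤ ℤ.^ n) {{_}} {{±1-nonZero n}}

F-nonZero : ∀ p .{{_ : ℤ.NonZero p}} → ℤ.NonZero (F p)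
F-nonZero +[1+ n ] = fib-nonZero n
F-nonZero -[1+ n ] =
  ℤ.i*j≢0 (-1ℤ ℤ.^ n) (+ fib (suc n)) {{±1-nonZero n}} {{fib-nonZero n}}

Fℚ-nonZero : ∀ p .{{_ : ℤ.NonZero p}} → ℚ.NonZero (Fℚ p)
Fℚ-nonZero p = fromℤ-nonZero (F p) {{F-nonZero p}}

FpFq-nonZero : ∀ p q .{{_ : ℤ.NonZero p}} .{{_ : ℤ.NonZero q}} → ℚ.NonZero (Fℚ p * Fℚ q)
FpFq-nonZero p q = *-nonZero (Fℚ p) (Fℚ q) {{Fℚ-nonZero p}} {{Fℚ-nonZero q}}

2FqFp-nonZero : ∀ n p q .{{_ : ℤ.NonZero p}} .{{_ : ℤ.NonZero q}} →
                ℚ.NonZero (fromℤ (+ 2) * Fℚ q ^ (2 ℕ.* n) * Fℚ p ^ (2 ℕ.* n))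
2FqFp-nonZero n p q =
  *-nonZero (fromℤ (+ 2) * Fℚ q ^ (2 ℕ.* n)) (Fℚ p ^ (2 ℕ.* n))
    {{*-nonZero (fromℤ (+ 2)) (Fℚ q ^ (2 ℕ.* n)) {{_}} {{^-nonZero (Fℚ q) (2 ℕ.* n) {{Fℚ-nonZero q}}}}}}
    {{^-nonZero (Fℚ p) (2 ℕ.* n) {{Fℚ-nonZero p}}}}

module Submission where

open import Defs
open import Data.Nat.Base as ℕ using (ℕ; zero; suc; z≤n; s≤s)
import Data.Nat.Properties as ℕ
import Data.Nat.Solver as ℕ
open import Data.Nat.Combinatorics using (_C_; nCk≡nC[n∸k]; nCk+nC[k+1]≡[n+1]C[k+1])
open import Data.Nat.Combinatorics.Specification using (k>n⇒nCk≡0)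
open import Data.Integer.Base as ℤ using (ℤ; +_; -[1+_]; +[1+_])
import Data.Integer.Properties as ℤ
import Data.Integer.Solver as ℤ
open import Data.Rational.Base as ℚ using (ℚ; _*_; _+_; _-_; _÷_; -_; 1ℚ; 0ℚ; 1/_; _/_)
import Data.Rational.Properties as ℚ
open import Data.Rational.Solver using (module +-*-Solver)
import Data.Rational.Unnormalised.Base as ℚᵘ
import Data.Rational.Unnormalised.Properties as ℚᵘ
open import Data.Fin.Base using (toℕ)
open import Data.Fin.Properties using (toℕ≤pred[n])
open import Data.Product.Base using (_×_; _,_; proj₁)
open import Algebra.Bundles using (CommutativeRing)
open import Algebra.Properties.Group ℚ.+-0-group using (∙-cancelˡ; ⁻¹-injective)
open import Algebra.Properties.Semiring.Exp (CommutativeRing.semiring ℚ.+-*-commutativeRing)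
  using (^-homo-*; ^-assocʳ)
open import Algebra.Properties.CommutativeSemiring.Exp
  (CommutativeRing.commutativeSemiring ℚ.+-*-commutativeRing) using (^-distrib-*)
open import Algebra.Properties.Semiring.Sum (CommutativeRing.semiring ℚ.+-*-commutativeRing)
  using (sum; sum-cong-≋; *-distribˡ-sum)
open import Relation.Binary.PropositionalEquality
  using (_≡_; refl; sym; trans; cong; cong₂; module ≡-Reasoning)
open ≡-Reasoning

-- Put a = F_p/F_q, b = 1/a and ε = (-1)^(p-q).  Catalan's identity
-- F_{p+q}F_{p-q} = F_p² - εF_q² turns the base of the power into z = a - εb.  With w = εz²,
-- r = εa² and s = εb² one has rs = 1 and r + s = w + 2, so rⁿ + sⁿ satisfies
-- x_{n+2} + x_n = (w + 2)x_{n+1}.  The polynomial Σ_k (2n/(n+k))·C(n+k, n-k)·wᵏ satisfies the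
-- same recurrence, because its coefficients are C(n+k, 2k) + C(n+k-1, 2k).

-- Integers inside the rationals

toℚᵘ-fromℤ : ∀ i → ℚ.toℚᵘ (fromℤ i) ℚᵘ.≃ ℚᵘ.mkℚᵘ i 0
toℚᵘ-fromℤ i = ℚ.toℚᵘ-fromℚᵘ (ℚᵘ.mkℚᵘ i 0)

-- The fraction `i / 1` is normalised by a gcd that does not reduce for a variable `i`, so both
-- sides are compared as unnormalised rationals, where equality is cross-multiplication.
fromℤ-+ : ∀ i j → fromℤ (i ℤ.+ j) ≡ fromℤ i + fromℤ j
fromℤ-+ i j = ℚ.toℚᵘ-injective
  (ℚᵘ.≃-trans (toℚᵘ-fromℤ (i ℤ.+ j))
  (ℚᵘ.≃-trans (ℚᵘ.*≡* (cong (ℤ._* ℤ.1ℤ) (sym (cong₂ ℤ._+_ (ℤ.*-identityʳ i) (ℤ.*-identityʳ j)))))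
  (ℚᵘ.≃-trans (ℚᵘ.≃-sym (ℚᵘ.+-cong (toℚᵘ-fromℤ i) (toℚᵘ-fromℤ j)))
              (ℚᵘ.≃-sym (ℚ.toℚᵘ-homo-+ (fromℤ i) (fromℤ j))))))

fromℤ-* : ∀ i j → fromℤ (i ℤ.* j) ≡ fromℤ i * fromℤ j
fromℤ-* i j = ℚ.toℚᵘ-injective
  (ℚᵘ.≃-trans (toℚᵘ-fromℤ (i ℤ.* j))
  (ℚᵘ.≃-trans (ℚᵘ.≃-sym (ℚᵘ.*-cong (toℚᵘ-fromℤ i) (toℚᵘ-fromℤ j)))
              (ℚᵘ.≃-sym (ℚ.toℚᵘ-homo-* (fromℤ i) (fromℤ j)))))

i/d*d≡i : ∀ i d .{{_ : ℕ.NonZero d}} → (i / d) * fromℤ (+ d) ≡ fromℤ i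
i/d*d≡i i (suc d) = ℚ.toℚᵘ-injective
  (ℚᵘ.≃-trans (ℚ.toℚᵘ-homo-* (i / suc d) (fromℤ +[1+ d ]))
  (ℚᵘ.≃-trans (ℚᵘ.*-cong (ℚ.toℚᵘ-fromℚᵘ (ℚᵘ.mkℚᵘ i d)) (toℚᵘ-fromℤ +[1+ d ]))
  (ℚᵘ.≃-trans (ℚᵘ.*≡* (trans (ℤ.*-identityʳ (i ℤ.* +[1+ d ]))
                             (cong (λ m → i ℤ.* + m) (sym (ℕ.*-identityʳ (suc d))))))
              (ℚᵘ.≃-sym (toℚᵘ-fromℤ i)))))

-- Fibonacci numbers with integer indices

ℤ-induction : (P : ℤ → Set) → P (+ 0) →
  (∀ i → P i → P (ℤ.suc i)) → (∀ i → P (ℤ.suc i) → P i) → ∀ i → P i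
ℤ-induction P P0 up down (+ zero)       = P0
ℤ-induction P P0 up down +[1+ n ]       = up (+ n) (ℤ-induction P P0 up down (+ n))
ℤ-induction P P0 up down -[1+ zero ]    = down -[1+ 0 ] P0
ℤ-induction P P0 up down -[1+ suc n ]   =
  down -[1+ suc n ] (ℤ-induction P P0 up down -[1+ n ])

FibonacciLike : (ℤ → ℚ) → Set
FibonacciLike G = ∀ i → G (ℤ.suc (ℤ.suc i)) ≡ G (ℤ.suc i) + G i

-- The induction carries two consecutive values. Downwards, the recurrence determines `G i` after
-- cancelling `G (ℤ.suc i)`.
FibonacciLike-unique : ∀ {G H} → FibonacciLike G → FibonacciLike H →
  G (+ 0) ≡ H (+ 0) → G (+ 1) ≡ H (+ 1) → ∀ i → G i ≡ H i
FibonacciLike-unique {G} {H} recG recH eq₀ eq₁ i = proj₁ (ℤ-induction P (eq₀ , eq₁) up down i)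
  where
  P : ℤ → Set
  P i = (G i ≡ H i) × (G (ℤ.suc i) ≡ H (ℤ.suc i))

  up : ∀ i → P i → P (ℤ.suc i)
  up i (eq , eq′) = eq′ , trans (recG i) (trans (cong₂ _+_ eq′ eq) (sym (recH i)))

  down : ∀ i → P (ℤ.suc i) → P i
  down i (eq′ , eq″) =
    ∙-cancelˡ (G (ℤ.suc i)) (G i) (H i)
      (trans (sym (recG i)) (trans eq″ (trans (recH i) (cong (_+ H i) (sym eq′)))))
    , eq′

F-suc-suc : ∀ i → F (ℤ.suc (ℤ.suc i)) ≡ F (ℤ.suc i) ℤ.+ F i
F-suc-suc (+ n)                 = refl
F-suc-suc -[1+ 0 ]              = refl
F-suc-suc -[1+ 1 ]              = refl
-- The earlier cases meet index 0 and compute. Here s = (-1)^n, a = F_{n+1}, b = F_{n+2}, and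
-- `fib (3 + n)` unfolds to b + a.
F-suc-suc -[1+ suc (suc n) ]    = ℤ-solve 3
  (λ s a b → s :* a :=
    (con ℤ.-1ℤ :* s) :* b :+ (con ℤ.-1ℤ :* (con ℤ.-1ℤ :* s)) :* (b :+ a))
  refl (ℤ.-1ℤ ℤ.^ n) (+ fib (suc n)) (+ fib (suc (suc n)))
  where open ℤ.+-*-Solver renaming (solve to ℤ-solve)

Fℚ-suc-suc : FibonacciLike Fℚ
Fℚ-suc-suc i = trans (cong fromℤ (F-suc-suc i)) (fromℤ-+ (F (ℤ.suc i)) (F i))

shift-FibonacciLike : ∀ {G} → FibonacciLike G → ∀ j → FibonacciLike (λ i → G (i ℤ.+ j))
shift-FibonacciLike {G} rec j i = begin
  G (ℤ.suc (ℤ.suc i) ℤ.+ j)         ≡⟨ cong G (ℤ.+-assoc ℤ.1ℤ (ℤ.suc i) j) ⟩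
  G (ℤ.suc (ℤ.suc i ℤ.+ j))         ≡⟨ cong (λ m → G (ℤ.suc m)) (ℤ.+-assoc ℤ.1ℤ i j) ⟩
  G (ℤ.suc (ℤ.suc (i ℤ.+ j)))       ≡⟨ rec (i ℤ.+ j) ⟩
  G (ℤ.suc (i ℤ.+ j)) + G (i ℤ.+ j) ≡⟨ cong (λ m → G m + G (i ℤ.+ j)) (ℤ.+-assoc ℤ.1ℤ i j) ⟨
  G (ℤ.suc i ℤ.+ j) + G (i ℤ.+ j)   ∎

-- The exponent is an integer and the body uses `_^ℤ_`, so that the sign in the theorem is an
-- instance of `sgn` by unfolding.
sgn : ℤ → ℚ
sgn i = (- 1ℚ) ^ℤ i

sgn-suc : ∀ i → sgn (ℤ.suc i) ≡ - sgn i
sgn-suc (+ n)          = solve 1 (λ x → con (- 1ℚ) :* x := :- x) refl (sgn (+ n))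
  where open +-*-Solver
sgn-suc -[1+ zero ]    = refl
sgn-suc -[1+ suc n ]   = solve 1 (λ x → x := :- (con (- 1ℚ) :* x)) refl (sgn -[1+ n ])
  where open +-*-Solver

-- This is F_j F_{i+1} + F_{j-1} F_i with F_{j-1} = F_{j+1} - F_j, so that only successors occur.
-- Both sides are Fibonacci-like in `i` and agree at 0 and 1.
addition : ∀ i j → Fℚ (i ℤ.+ j) ≡
  Fℚ j * Fℚ (ℤ.suc i) + Fℚ (ℤ.suc j) * Fℚ i - Fℚ j * Fℚ i
addition i j = FibonacciLike-unique (shift-FibonacciLike {Fℚ} Fℚ-suc-suc j) rec base₀ base₁ i
  where
  open +-*-Solver
  H : ℤ → ℚ
  H i = Fℚ j * Fℚ (ℤ.suc i) + Fℚ (ℤ.suc j) * Fℚ i - Fℚ j * Fℚ i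

  rec : FibonacciLike H
  rec i rewrite Fℚ-suc-suc (ℤ.suc i) | Fℚ-suc-suc i = solve 4
    (λ a a′ b b′ → a :* ((b′ :+ b) :+ b′) :+ a′ :* (b′ :+ b) :- a :* (b′ :+ b) :=
       (a :* (b′ :+ b) :+ a′ :* b′ :- a :* b′) :+ (a :* b′ :+ a′ :* b :- a :* b))
    refl (Fℚ j) (Fℚ (ℤ.suc j)) (Fℚ i) (Fℚ (ℤ.suc i))

  base₀ : Fℚ (+ 0 ℤ.+ j) ≡ H (+ 0)
  base₀ = trans (cong Fℚ (ℤ.+-identityˡ j))
    (solve 2 (λ a a′ → a := a :* con 1ℚ :+ a′ :* con 0ℚ :- a :* con 0ℚ) refl (Fℚ j) (Fℚ (ℤ.suc j)))

  base₁ : Fℚ (+ 1 ℤ.+ j) ≡ H (+ 1)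
  base₁ = solve 2 (λ a a′ → a′ := a :* con 1ℚ :+ a′ :* con 1ℚ :- a :* con 1ℚ) refl (Fℚ j) (Fℚ (ℤ.suc j))

-- The left side is F_{i+1}F_{i-1} - F_i². It changes sign when `i` grows by 1, as `sgn` does, and a
-- change of sign can be undone for the downward step.
cassini : ∀ i → let a = Fℚ i; a′ = Fℚ (ℤ.suc i) in a′ * a′ - a * a′ - a * a ≡ sgn i
cassini = ℤ-induction (λ i → Q i ≡ sgn i) refl
  (λ i eq → trans (Q-suc i) (trans (cong -_ eq) (sym (sgn-suc i))))
  (λ i eq → ⁻¹-injective (trans (sym (Q-suc i)) (trans eq (sgn-suc i))))
  where
  open +-*-Solver
  Q : ℤ → ℚ
  Q i = let a = Fℚ i; a′ = Fℚ (ℤ.suc i) in a′ * a′ - a * a′ - a * a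

  Q-suc : ∀ i → Q (ℤ.suc i) ≡ - Q i
  Q-suc i rewrite Fℚ-suc-suc i = solve 2
    (λ a a′ → (a′ :+ a) :* (a′ :+ a) :- a′ :* (a′ :+ a) :- a′ :* a′ :=
              :- (a′ :* a′ :- a :* a′ :- a :* a))
    refl (Fℚ i) (Fℚ (ℤ.suc i))

-- Both sides are Fibonacci-like in `i`; they vanish at 0, and at 1 they agree by `cassini`. With i
-- = p - q and j = q this expresses F_{p-q} through values at p and q.
d’Ocagne : ∀ i j → sgn j * Fℚ i ≡
  Fℚ (i ℤ.+ j) * Fℚ (ℤ.suc j) - Fℚ (ℤ.suc (i ℤ.+ j)) * Fℚ j
d’Ocagne i j = FibonacciLike-unique recG recH base₀ base₁ i
  where
  open +-*-Solver
  G H : ℤ → ℚ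
  G i = sgn j * Fℚ i
  H i = Fℚ (i ℤ.+ j) * Fℚ (ℤ.suc j) - Fℚ (ℤ.suc (i ℤ.+ j)) * Fℚ j

  recG : FibonacciLike G
  recG i = trans (cong (sgn j *_) (Fℚ-suc-suc i)) (ℚ.*-distribˡ-+ (sgn j) (Fℚ (ℤ.suc i)) (Fℚ i))

  recH : FibonacciLike H
  recH i rewrite ℤ.+-assoc ℤ.1ℤ (ℤ.suc i) j | ℤ.+-assoc ℤ.1ℤ i j
    | Fℚ-suc-suc (ℤ.suc (i ℤ.+ j)) | Fℚ-suc-suc (i ℤ.+ j) = solve 4
    (λ a a′ b b′ → (a′ :+ a) :* b′ :- ((a′ :+ a) :+ a′) :* b :=
       (a′ :* b′ :- (a′ :+ a) :* b) :+ (a :* b′ :- a′ :* b))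
    refl (Fℚ (i ℤ.+ j)) (Fℚ (ℤ.suc (i ℤ.+ j))) (Fℚ j) (Fℚ (ℤ.suc j))

  base₀ : G (+ 0) ≡ H (+ 0)
  base₀ rewrite ℤ.+-identityˡ j = solve 3
    (λ s b b′ → s :* con 0ℚ := b :* b′ :- b′ :* b) refl (sgn j) (Fℚ j) (Fℚ (ℤ.suc j))

  base₁ : G (+ 1) ≡ H (+ 1)
  base₁ rewrite Fℚ-suc-suc j | sym (cassini j) = solve 2
    (λ b b′ → (b′ :* b′ :- b :* b′ :- b :* b) :* con 1ℚ := b′ :* b′ :- (b′ :+ b) :* b)
    refl (Fℚ j) (Fℚ (ℤ.suc j))

sgn-+ : ∀ i j → sgn (i ℤ.+ j) ≡ sgn i * sgn j
sgn-+ i j = ℤ-induction (λ i → sgn (i ℤ.+ j) ≡ sgn i * sgn j)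
  (trans (cong sgn (ℤ.+-identityˡ j)) (sym (ℚ.*-identityˡ (sgn j))))
  (λ i eq → trans (left i) (trans (cong -_ eq) (sym (right i))))
  (λ i eq → ⁻¹-injective (trans (sym (left i)) (trans eq (right i))))
  i
  where
  left : ∀ i → sgn (ℤ.suc i ℤ.+ j) ≡ - sgn (i ℤ.+ j)
  left i = trans (cong sgn (ℤ.+-assoc ℤ.1ℤ i j)) (sgn-suc (i ℤ.+ j))

  right : ∀ i → sgn (ℤ.suc i) * sgn j ≡ - (sgn i * sgn j)
  right i = trans (cong (_* sgn j) (sgn-suc i)) (sym (ℚ.neg-distribˡ-* (sgn i) (sgn j)))

sgn*sgn≡1 : ∀ i → sgn i * sgn i ≡ 1ℚ
sgn*sgn≡1 = ℤ-induction (λ i → sgn i * sgn i ≡ 1ℚ) refl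
  (λ i eq → trans (square i) eq) (λ i eq → trans (sym (square i)) eq)
  where
  open +-*-Solver
  square : ∀ i → sgn (ℤ.suc i) * sgn (ℤ.suc i) ≡ sgn i * sgn i
  square i rewrite sgn-suc i = solve 1 (λ s → (:- s) :* (:- s) := s :* s) refl (sgn i)

sgn-* : ∀ i n → sgn (i ℤ.* + n) ≡ sgn i ^ n
sgn-* i zero    = cong sgn (ℤ.*-zeroʳ i)
sgn-* i (suc n) = begin
  sgn (i ℤ.* +[1+ n ])       ≡⟨ cong sgn (ℤ.*-suc i (+ n)) ⟩
  sgn (i ℤ.+ i ℤ.* + n)      ≡⟨ sgn-+ i (i ℤ.* + n) ⟩
  sgn i * sgn (i ℤ.* + n)    ≡⟨ cong (sgn i *_) (sgn-* i n) ⟩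
  sgn i * sgn i ^ n          ∎

-- Inserting (sgn q)² = 1 gives F_{p-q} the sign that `d’Ocagne` requires, while `addition` expands
-- F_{p+q}.
catalan : ∀ p q →
  Fℚ (p ℤ.+ q) * Fℚ (p ℤ.- q) ≡ Fℚ p * Fℚ p - sgn (p ℤ.- q) * (Fℚ q * Fℚ q)
catalan p q = begin
  Fℚ (p ℤ.+ q) * Fℚ j
    ≡⟨ ℚ.*-identityˡ _ ⟨
  1ℚ * (Fℚ (p ℤ.+ q) * Fℚ j)
    ≡⟨ cong (_* (Fℚ (p ℤ.+ q) * Fℚ j)) (sgn*sgn≡1 q) ⟨
  (sgn q * sgn q) * (Fℚ (p ℤ.+ q) * Fℚ j)
    ≡⟨ solve 3 (λ s x y → (s :* s) :* (x :* y) := s :* (x :* (s :* y))) refl (sgn q) (Fℚ (p ℤ.+ q)) (Fℚ j) ⟩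
  sgn q * (Fℚ (p ℤ.+ q) * (sgn q * Fℚ j))
    ≡⟨ cong (sgn q *_) (cong₂ _*_ (addition p q) docagne) ⟩
  sgn q * ((b * a′ + b′ * a - b * a) * (a * b′ - a′ * b))
    -- The terms in a·a′·b·b′ cancel. Subtracting and adding a²b² completes the factors of a² and b²
    -- to the Cassini forms at q and p.
    ≡⟨ solve 5 (λ s a a′ b b′ → s :* ((b :* a′ :+ b′ :* a :- b :* a) :* (a :* b′ :- a′ :* b)) :=
         s :* ((b′ :* b′ :- b :* b′ :- b :* b) :* (a :* a) :- (a′ :* a′ :- a :* a′ :- a :* a) :* (b :* b)))
         refl (sgn q) a a′ b b′ ⟩
  sgn q * ((b′ * b′ - b * b′ - b * b) * (a * a) - (a′ * a′ - a * a′ - a * a) * (b * b))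
    ≡⟨ cong₂ (λ x y → sgn q * (x * (a * a) - y * (b * b))) (cassini q) (trans (cassini p) sgn-p) ⟩
  sgn q * (sgn q * (a * a) - (sgn j * sgn q) * (b * b))
    ≡⟨ solve 4 (λ s t x y → s :* (s :* x :- (t :* s) :* y) := (s :* s) :* (x :- t :* y))
         refl (sgn q) (sgn j) (a * a) (b * b) ⟩
  (sgn q * sgn q) * (a * a - sgn j * (b * b))
    ≡⟨ cong (_* (a * a - sgn j * (b * b))) (sgn*sgn≡1 q) ⟩
  1ℚ * (a * a - sgn j * (b * b))
    ≡⟨ ℚ.*-identityˡ _ ⟩
  a * a - sgn j * (b * b) ∎
  where
  open +-*-Solver
  j = p ℤ.- q
  a = Fℚ p
  a′ = Fℚ (ℤ.suc p)
  b = Fℚ q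
  b′ = Fℚ (ℤ.suc q)

  j+q≡p : j ℤ.+ q ≡ p
  j+q≡p = trans (ℤ.+-assoc p (ℤ.- q) q)
    (trans (cong (λ z → p ℤ.+ z) (ℤ.+-inverseˡ q)) (ℤ.+-identityʳ p))

  docagne : sgn q * Fℚ j ≡ a * b′ - a′ * b
  docagne = trans (d’Ocagne j q) (cong (λ m → Fℚ m * b′ - Fℚ (ℤ.suc m) * b) j+q≡p)

  sgn-p : sgn p ≡ sgn j * sgn q
  sgn-p = trans (cong sgn (sym j+q≡p)) (sgn-+ j q)

-- The coefficients

fromℕ : ℕ → ℚ
fromℕ n = fromℤ (+ n)

fromℕ-+ : ∀ m n → fromℕ (m ℕ.+ n) ≡ fromℕ m + fromℕ n
fromℕ-+ m n = fromℤ-+ (+ m) (+ n)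

fromℕ-* : ∀ m n → fromℕ (m ℕ.* n) ≡ fromℕ m * fromℕ n
fromℕ-* m n = trans (cong fromℤ (ℤ.pos-* m n)) (fromℤ-* (+ m) (+ n))

-- Twice n/(n+k)·C(n+k, n-k) when k ≤ n, and 0 when k > n.
coeff₂ : ℕ → ℕ → ℕ
coeff₂ n k = (n ℕ.+ k) C (2 ℕ.* k) ℕ.+ (n ℕ.+ k ℕ.∸ 1) C (2 ℕ.* k)

-- Both upper indices, n+k and n+k-1, are below 2k. This lets the sums run past `n` without
-- changing.
coeff₂-vanish : ∀ n k → n ℕ.< k → coeff₂ n k ≡ 0
coeff₂-vanish n k n<k = cong₂ ℕ._+_
  (k>n⇒nCk≡0 n+k<2k)
  (k>n⇒nCk≡0 (ℕ.≤-<-trans (ℕ.m∸n≤m (n ℕ.+ k) 1) n+k<2k))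
  where
  n+k<2k : n ℕ.+ k ℕ.< 2 ℕ.* k
  n+k<2k rewrite ℕ.+-identityʳ k = ℕ.+-monoˡ-< k n<k

[n+1]C[k+1]*[k+1]≡[n+1]*nCk : ∀ n k → (suc n C suc k) ℕ.* suc k ≡ suc n ℕ.* (n C k)
[n+1]C[k+1]*[k+1]≡[n+1]*nCk zero    zero    = refl
[n+1]C[k+1]*[k+1]≡[n+1]*nCk zero    (suc k)
  rewrite k>n⇒nCk≡0 {1} {suc (suc k)} (s≤s (s≤s z≤n)) | k>n⇒nCk≡0 {0} {suc k} (s≤s z≤n) = refl
[n+1]C[k+1]*[k+1]≡[n+1]*nCk (suc n) zero
  rewrite sym (nCk+nC[k+1]≡[n+1]C[k+1] (suc n) 0) = begin
  (1 ℕ.+ (suc n C 1)) ℕ.* 1   ≡⟨ cong (λ c → 1 ℕ.* 1 ℕ.+ c) ([n+1]C[k+1]*[k+1]≡[n+1]*nCk n 0) ⟩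
  suc (suc n ℕ.* 1)           ∎
[n+1]C[k+1]*[k+1]≡[n+1]*nCk (suc n) (suc k) = begin
  (suc (suc n) C suc (suc k)) ℕ.* suc (suc k)
    ≡⟨ cong (ℕ._* suc (suc k)) (nCk+nC[k+1]≡[n+1]C[k+1] (suc n) (suc k)) ⟨
  (x ℕ.+ y) ℕ.* suc (suc k)
    -- Only x·(k+1) and y·(k+2) fit the induction hypotheses; the spare x later raises the factor
    -- n+1 to n+2.
    ≡⟨ solve 3 (λ x y k → (x :+ y) :* (con 2 :+ k) := (x :+ x :* (con 1 :+ k)) :+ y :* (con 2 :+ k)) refl x y k ⟩
  (x ℕ.+ x ℕ.* suc k) ℕ.+ y ℕ.* suc (suc k)
    ≡⟨ cong₂ (λ u v → (x ℕ.+ u) ℕ.+ v)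
         ([n+1]C[k+1]*[k+1]≡[n+1]*nCk n k) ([n+1]C[k+1]*[k+1]≡[n+1]*nCk n (suc k)) ⟩
  (x ℕ.+ suc n ℕ.* (n C k)) ℕ.+ suc n ℕ.* (n C suc k)
    ≡⟨ solve 4 (λ x n u v → (x :+ n :* u) :+ n :* v := x :+ n :* (u :+ v)) refl x (suc n) (n C k) (n C suc k) ⟩
  x ℕ.+ suc n ℕ.* ((n C k) ℕ.+ (n C suc k))
    ≡⟨ cong (λ c → x ℕ.+ suc n ℕ.* c) (nCk+nC[k+1]≡[n+1]C[k+1] n k) ⟩
  suc (suc n) ℕ.* x ∎
  where
  open ℕ.+-*-Solver
  x = suc n C suc k
  y = suc n C suc (suc k)

[m+j]Cj≡[m+j]Cm : ∀ m j → (m ℕ.+ j) C j ≡ (m ℕ.+ j) C m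
[m+j]Cj≡[m+j]Cm m j = trans (nCk≡nC[n∸k] (ℕ.m≤n+m j m)) (cong ((m ℕ.+ j) C_) (ℕ.m+n∸n≡m m j))

-- The absorption identity N·C(N-1, m) = (N-m)·C(N, m), with N = m + j.
absorption : ∀ m j .{{_ : ℕ.NonZero (m ℕ.+ j)}} →
  j ℕ.* ((m ℕ.+ j) C j) ≡ (m ℕ.+ j) ℕ.* ((m ℕ.+ j ℕ.∸ 1) C m)
absorption m@(suc m′) zero = sym (trans
  (cong ((m ℕ.+ 0) ℕ.*_) (k>n⇒nCk≡0 (s≤s (ℕ.≤-reflexive (ℕ.+-identityʳ m′)))))
  (ℕ.*-zeroʳ (m ℕ.+ 0)))
absorption m (suc j) rewrite ℕ.+-suc m j = begin
  suc j ℕ.* (suc (m ℕ.+ j) C suc j)     ≡⟨ ℕ.*-comm (suc j) (suc (m ℕ.+ j) C suc j) ⟩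
  (suc (m ℕ.+ j) C suc j) ℕ.* suc j     ≡⟨ [n+1]C[k+1]*[k+1]≡[n+1]*nCk (m ℕ.+ j) j ⟩
  suc (m ℕ.+ j) ℕ.* ((m ℕ.+ j) C j)     ≡⟨ cong (suc (m ℕ.+ j) ℕ.*_) ([m+j]Cj≡[m+j]Cm m j) ⟩
  suc (m ℕ.+ j) ℕ.* ((m ℕ.+ j) C m)     ∎

k+j+k≡2*k+j : ∀ k j → (k ℕ.+ j) ℕ.+ k ≡ 2 ℕ.* k ℕ.+ j
k+j+k≡2*k+j = solve 2 (λ k j → (k :+ j) :+ k := con 2 :* k :+ j) refl
  where open ℕ.+-*-Solver

-- With n = k + j one has n + k = 2k + j. Symmetry and absorption turn the two binomials into
-- multiples of C(2k+j, j), with total factor (2k+j) + j = 2n.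
[n+k]*coeff₂≡2*n*C : ∀ k j → let n = k ℕ.+ j in .{{_ : ℕ.NonZero (n ℕ.+ k)}} →
  (n ℕ.+ k) ℕ.* coeff₂ n k ≡ (2 ℕ.* n) ℕ.* ((n ℕ.+ k) C j)
[n+k]*coeff₂≡2*n*C k j rewrite k+j+k≡2*k+j k j = begin
  (2 ℕ.* k ℕ.+ j) ℕ.* (x ℕ.+ y)                     ≡⟨ ℕ.*-distribˡ-+ (2 ℕ.* k ℕ.+ j) x y ⟩
  (2 ℕ.* k ℕ.+ j) ℕ.* x ℕ.+ (2 ℕ.* k ℕ.+ j) ℕ.* y
    ≡⟨ cong₂ (λ u v → (2 ℕ.* k ℕ.+ j) ℕ.* u ℕ.+ v) ([m+j]Cj≡[m+j]Cm (2 ℕ.* k) j) (absorption (2 ℕ.* k) j) ⟨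
  (2 ℕ.* k ℕ.+ j) ℕ.* z ℕ.+ j ℕ.* z
    ≡⟨ solve 3 (λ k j z → (con 2 :* k :+ j) :* z :+ j :* z := (con 2 :* (k :+ j)) :* z) refl k j z ⟩
  (2 ℕ.* (k ℕ.+ j)) ℕ.* z ∎
  where
  open ℕ.+-*-Solver
  x = (2 ℕ.* k ℕ.+ j) C (2 ℕ.* k)
  y = (2 ℕ.* k ℕ.+ j ℕ.∸ 1) C (2 ℕ.* k)
  z = (2 ℕ.* k ℕ.+ j) C j

-- The denominator n + k is cleared. At n = k = 0 truncated subtraction makes `coeff₂` equal to 1 +
-- 1, in accord with the convention that the coefficient is 1.
2*coeff≡coeff₂ : ∀ n k → k ℕ.≤ n → fromℕ 2 * coeff n k ≡ fromℕ (coeff₂ n k)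
2*coeff≡coeff₂ zero      zero k≤n = refl
2*coeff≡coeff₂ n@(suc _) k    k≤n = begin
  fromℕ 2 * (x * c)
    ≡⟨ ℚ.*-identityˡ _ ⟨
  1ℚ * (fromℕ 2 * (x * c))
    ≡⟨ cong (_* (fromℕ 2 * (x * c))) (ℚ.*-inverseˡ N) ⟨
  (1/ N * N) * (fromℕ 2 * (x * c))
    ≡⟨ solve 5 (λ v N t x c → (v :* N) :* (t :* (x :* c)) := v :* ((t :* (x :* N)) :* c)) refl (1/ N) N (fromℕ 2) x c ⟩
  1/ N * ((fromℕ 2 * (x * N)) * c)
    ≡⟨ cong (λ m → 1/ N * ((fromℕ 2 * m) * c)) (i/d*d≡i (+ n) (n ℕ.+ k)) ⟩
  1/ N * ((fromℕ 2 * fromℕ n) * c)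
    ≡⟨ cong (λ m → 1/ N * (m * c)) (fromℕ-* 2 n) ⟨
  1/ N * (fromℕ (2 ℕ.* n) * c)
    ≡⟨ cong (1/ N *_) (fromℕ-* (2 ℕ.* n) ((n ℕ.+ k) C (n ℕ.∸ k))) ⟨
  1/ N * fromℕ ((2 ℕ.* n) ℕ.* ((n ℕ.+ k) C (n ℕ.∸ k)))
    ≡⟨ cong (λ m → 1/ N * fromℕ m) cleared ⟨
  1/ N * fromℕ ((n ℕ.+ k) ℕ.* coeff₂ n k)
    ≡⟨ cong (1/ N *_) (fromℕ-* (n ℕ.+ k) (coeff₂ n k)) ⟩
  1/ N * (N * d)
    ≡⟨ ℚ.*-assoc (1/ N) N d ⟨
  (1/ N * N) * d
    ≡⟨ cong (_* d) (ℚ.*-inverseˡ N) ⟩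
  1ℚ * d
    ≡⟨ ℚ.*-identityˡ d ⟩
  d ∎
  where
  open +-*-Solver
  x = + n / (n ℕ.+ k)
  c = fromℕ ((n ℕ.+ k) C (n ℕ.∸ k))
  N = fromℕ (n ℕ.+ k)
  d = fromℕ (coeff₂ n k)
  instance
    N≢0 : ℚ.NonZero N
    N≢0 = fromℤ-nonZero (+ (n ℕ.+ k))

  cleared : (n ℕ.+ k) ℕ.* coeff₂ n k ≡ (2 ℕ.* n) ℕ.* ((n ℕ.+ k) C (n ℕ.∸ k))
  cleared = from (ℕ.m+[n∸m]≡n k≤n)
    where
    -- Replacing n = k + (n ∸ k) directly would also affect the `n` inside `n ∸ k`. A separate
    -- variable `m` allows matching on `refl`.
    from : ∀ {m} → k ℕ.+ (n ℕ.∸ k) ≡ m → .{{_ : ℕ.NonZero (m ℕ.+ k)}} →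
      (m ℕ.+ k) ℕ.* coeff₂ m k ≡ (2 ℕ.* m) ℕ.* ((m ℕ.+ k) C (n ℕ.∸ k))
    from refl = [n+k]*coeff₂≡2*n*C k (n ℕ.∸ k)

-- Pascal's rule applied twice: the second difference of C(·, m+2) at n is C(n, m), written here
-- without subtraction.
pascal₂ : ∀ n m → (2 ℕ.+ n) C (2 ℕ.+ m) ℕ.+ n C (2 ℕ.+ m) ≡ n C m ℕ.+ 2 ℕ.* ((1 ℕ.+ n) C (2 ℕ.+ m))
pascal₂ n m
  rewrite sym (nCk+nC[k+1]≡[n+1]C[k+1] (1 ℕ.+ n) (1 ℕ.+ m))
        | sym (nCk+nC[k+1]≡[n+1]C[k+1] n m)
        | sym (nCk+nC[k+1]≡[n+1]C[k+1] n (1 ℕ.+ m)) =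
  solve 3 (λ x y z → ((x :+ y) :+ (y :+ z)) :+ z := x :+ con 2 :* (y :+ z)) refl
    (n C m) (n C suc m) (n C suc (suc m))
  where open ℕ.+-*-Solver

-- Each of the two binomials in `coeff₂` obeys `pascal₂`, at upper indices differing by 1. This is
-- the recurrence x_{n+2} + x_n = (w + 2)x_{n+1} read at the coefficient of w^{k+1}.
coeff₂-rec : ∀ n k → coeff₂ (2 ℕ.+ n) (suc k) ℕ.+ coeff₂ n (suc k) ≡
  coeff₂ (1 ℕ.+ n) k ℕ.+ 2 ℕ.* coeff₂ (1 ℕ.+ n) (suc k)
coeff₂-rec n k rewrite ℕ.+-suc n k | ℕ.+-suc k (k ℕ.+ 0) = begin
  (a ℕ.+ b) ℕ.+ (c ℕ.+ d)
    ≡⟨ solve 4 (λ a b c d → (a :+ b) :+ (c :+ d) := (a :+ c) :+ (b :+ d)) refl a b c d ⟩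
  (a ℕ.+ c) ℕ.+ (b ℕ.+ d)
    ≡⟨ cong₂ ℕ._+_ (pascal₂ (suc (n ℕ.+ k)) (2 ℕ.* k)) (pascal₂ (n ℕ.+ k) (2 ℕ.* k)) ⟩
  (e ℕ.+ 2 ℕ.* b) ℕ.+ (f ℕ.+ 2 ℕ.* c)
    ≡⟨ solve 4 (λ e b f c → (e :+ con 2 :* b) :+ (f :+ con 2 :* c) := (e :+ f) :+ con 2 :* (b :+ c)) refl e b f c ⟩
  (e ℕ.+ f) ℕ.+ 2 ℕ.* (b ℕ.+ c) ∎
  where
  open ℕ.+-*-Solver
  a = (3 ℕ.+ (n ℕ.+ k)) C (2 ℕ.+ 2 ℕ.* k)
  b = (2 ℕ.+ (n ℕ.+ k)) C (2 ℕ.+ 2 ℕ.* k)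
  c = (1 ℕ.+ (n ℕ.+ k)) C (2 ℕ.+ 2 ℕ.* k)
  d = (n ℕ.+ k) C (2 ℕ.+ 2 ℕ.* k)
  e = (1 ℕ.+ (n ℕ.+ k)) C (2 ℕ.* k)
  f = (n ℕ.+ k) C (2 ℕ.* k)

-- The polynomial identity

∑-cong : ∀ n {f g : ℕ → ℚ} → (∀ k → k ℕ.≤ n → f k ≡ g k) → ∑[ k ≤ n ] f k ≡ ∑[ k ≤ n ] g k
∑-cong n eq = sum-cong-≋ {suc n} (λ i → eq (toℕ i) (toℕ≤pred[n] i))

∑-*ˡ : ∀ n x (f : ℕ → ℚ) → ∑[ k ≤ n ] (x * f k) ≡ x * ∑[ k ≤ n ] f k
∑-*ˡ n x f = sym (*-distribˡ-sum {suc n} x (λ i → f (toℕ i)))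

∑-zero : ∀ n {f : ℕ → ℚ} → (∀ k → f k ≡ 0ℚ) → ∑[ k ≤ n ] f k ≡ 0ℚ
∑-zero zero    eq = trans (cong (_+ 0ℚ) (eq 0)) refl
∑-zero (suc n) eq = cong₂ _+_ (eq 0) (∑-zero n (λ k → eq (suc k)))

-- The shape is that of `term-rec`, which can thus be summed at once. The induction `go` counts
-- summands, since `∑[ k ≤ n ]` is never empty.
∑-linear : ∀ n (f g h l : ℕ → ℚ) x y → (∀ k → f k + g k ≡ x * h k + y * l k) →
  ∑[ k ≤ n ] f k + ∑[ k ≤ n ] g k ≡ x * ∑[ k ≤ n ] h k + y * ∑[ k ≤ n ] l k
∑-linear n f g h l x y eq = go (suc n) f g h l eq
  where
  open +-*-Solver
  go : ∀ m (f g h l : ℕ → ℚ) → (∀ k → f k + g k ≡ x * h k + y * l k) →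
    sum {m} (λ i → f (toℕ i)) + sum {m} (λ i → g (toℕ i)) ≡
    x * sum {m} (λ i → h (toℕ i)) + y * sum {m} (λ i → l (toℕ i))
  go zero    _ _ _ _ eq = solve 2 (λ x y → con 0ℚ :+ con 0ℚ := x :* con 0ℚ :+ y :* con 0ℚ) refl x y
  go (suc m) f g h l eq = begin
    (f 0 + Σ f) + (g 0 + Σ g)                       ≡⟨ interchange (f 0) (Σ f) (g 0) (Σ g) ⟩
    (f 0 + g 0) + (Σ f + Σ g)                       ≡⟨ cong₂ _+_ (eq 0)
      (go m (λ k → f (suc k)) (λ k → g (suc k)) (λ k → h (suc k)) (λ k → l (suc k)) (λ k → eq (suc k))) ⟩
    (x * h 0 + y * l 0) + (x * Σ h + y * Σ l)
      ≡⟨ solve 6 (λ x y a b c d → (x :* a :+ y :* b) :+ (x :* c :+ y :* d) :=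
                                  x :* (a :+ c) :+ y :* (b :+ d)) refl x y (h 0) (l 0) (Σ h) (Σ l) ⟩
    x * (h 0 + Σ h) + y * (l 0 + Σ l)               ∎
    where
    Σ : (ℕ → ℚ) → ℚ
    Σ f = sum {m} (λ i → f (suc (toℕ i)))

    interchange : ∀ a b c d → (a + b) + (c + d) ≡ (a + c) + (b + d)
    interchange = solve 4 (λ a b c d → (a :+ b) :+ (c :+ d) := (a :+ c) :+ (b :+ d)) refl

module _ (w : ℚ) where
  open +-*-Solver

  term : ℕ → ℕ → ℚ
  term n k = fromℕ (coeff₂ n k) * w ^ k

  term-vanish : ∀ n k → n ℕ.< k → term n k ≡ 0ℚ
  term-vanish n k n<k rewrite coeff₂-vanish n k n<k = ℚ.*-zeroˡ (w ^ k)

  term-rec : ∀ n k → term (2 ℕ.+ n) (suc k) + term n (suc k) ≡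
    w * term (1 ℕ.+ n) k + fromℕ 2 * term (1 ℕ.+ n) (suc k)
  term-rec n k = begin
    d₂ * (w * W) + d₀ * (w * W)     ≡⟨ ℚ.*-distribʳ-+ (w * W) d₂ d₀ ⟨
    (d₂ + d₀) * (w * W)             ≡⟨ cong (_* (w * W)) coefficients ⟩
    (d₁ + fromℕ 2 * d₁′) * (w * W)
      ≡⟨ solve 5 (λ c t d w W → (c :+ t :* d) :* (w :* W) := w :* (c :* W) :+ t :* (d :* (w :* W)))
           refl d₁ (fromℕ 2) d₁′ w W ⟩
    w * (d₁ * W) + fromℕ 2 * (d₁′ * (w * W)) ∎
    where
    d₂ = fromℕ (coeff₂ (2 ℕ.+ n) (suc k))
    d₀ = fromℕ (coeff₂ n (suc k))
    d₁ = fromℕ (coeff₂ (1 ℕ.+ n) k)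
    d₁′ = fromℕ (coeff₂ (1 ℕ.+ n) (suc k))
    W = w ^ k

    coefficients : d₂ + d₀ ≡ d₁ + fromℕ 2 * d₁′
    coefficients = begin
      d₂ + d₀  ≡⟨ fromℕ-+ (coeff₂ (2 ℕ.+ n) (suc k)) (coeff₂ n (suc k)) ⟨
      _      ≡⟨ cong fromℕ (coeff₂-rec n k) ⟩
      _      ≡⟨ fromℕ-+ (coeff₂ (1 ℕ.+ n) k) (2 ℕ.* coeff₂ (1 ℕ.+ n) (suc k)) ⟩
      _      ≡⟨ cong (λ m → d₁ + m) (fromℕ-* 2 (coeff₂ (1 ℕ.+ n) (suc k))) ⟩
      d₁ + fromℕ 2 * d₁′ ∎

  -- Every constant term is 2, so the k = 0 terms balance as 2 + 2 = 2·2. The others follow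
  -- `term-rec`, whose shift of `k` makes the sum multiplied by `w` stop at `N`.
  ∑-term-rec : ∀ n N → ∑[ k ≤ suc N ] term (2 ℕ.+ n) k + ∑[ k ≤ suc N ] term n k ≡
    w * ∑[ k ≤ N ] term (1 ℕ.+ n) k + fromℕ 2 * ∑[ k ≤ suc N ] term (1 ℕ.+ n) k
  ∑-term-rec n N = begin
    (two + S₂) + (two + S₀)
      ≡⟨ solve 3 (λ t a b → (t :+ a) :+ (t :+ b) := (con (fromℕ 2) :* t) :+ (a :+ b)) refl two S₂ S₀ ⟩
    fromℕ 2 * two + (S₂ + S₀)
      ≡⟨ cong (λ z → fromℕ 2 * two + z) (∑-linear N (λ k → term (2 ℕ.+ n) (suc k)) (λ k → term n (suc k))
           (term (1 ℕ.+ n)) (λ k → term (1 ℕ.+ n) (suc k)) w (fromℕ 2) (term-rec n)) ⟩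
    fromℕ 2 * two + (w * T + fromℕ 2 * S₁)
      ≡⟨ solve 5 (λ c t w T S → c :* t :+ (w :* T :+ c :* S) := w :* T :+ c :* (t :+ S))
           refl (fromℕ 2) two w T S₁ ⟩
    w * T + fromℕ 2 * (two + S₁) ∎
    where
    two = fromℕ 2 * 1ℚ
    S₂ = ∑[ k ≤ N ] term (2 ℕ.+ n) (suc k)
    S₁ = ∑[ k ≤ N ] term (1 ℕ.+ n) (suc k)
    S₀ = ∑[ k ≤ N ] term n (suc k)
    T  = ∑[ k ≤ N ] term (1 ℕ.+ n) k

  -- Summing up to any N ≥ n keeps the three sums of ∑-term-rec within the induction hypothesis.
  ∑-term≡rⁿ+sⁿ : ∀ r s → r * s ≡ 1ℚ → r + s ≡ w + fromℕ 2 →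
    ∀ n N → n ℕ.≤ N → ∑[ k ≤ N ] term n k ≡ r ^ n + s ^ n
  ∑-term≡rⁿ+sⁿ r s rs≡1 r+s≡w+2 zero zero _ = refl
  ∑-term≡rⁿ+sⁿ r s rs≡1 r+s≡w+2 zero (suc N) _ =
    cong (λ z → fromℕ 2 * 1ℚ + z) (∑-zero N (λ k → term-vanish 0 (suc k) (s≤s z≤n)))
  ∑-term≡rⁿ+sⁿ r s rs≡1 r+s≡w+2 (suc zero) (suc N) _ = begin
    fromℕ 2 * 1ℚ + ∑[ k ≤ N ] term 1 (suc k)   ≡⟨ cong (λ z → fromℕ 2 * 1ℚ + z) (tail N) ⟩
    fromℕ 2 * 1ℚ + (1ℚ * (w * 1ℚ) + 0ℚ)
      ≡⟨ solve 1 (λ w → con (fromℕ 2) :* con 1ℚ :+ (con 1ℚ :* (w :* con 1ℚ) :+ con 0ℚ) := w :+ con (fromℕ 2)) refl w ⟩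
    w + fromℕ 2                                 ≡⟨ r+s≡w+2 ⟨
    r + s                                       ≡⟨ cong₂ _+_ (ℚ.*-identityʳ r) (ℚ.*-identityʳ s) ⟨
    r * 1ℚ + s * 1ℚ                             ∎
    where
    tail : ∀ N → ∑[ k ≤ N ] term 1 (suc k) ≡ 1ℚ * (w * 1ℚ) + 0ℚ
    tail zero    = refl
    tail (suc N) = cong (λ z → 1ℚ * (w * 1ℚ) + z) (∑-zero N (λ k → term-vanish 1 (suc (suc k)) (s≤s (s≤s z≤n))))
  ∑-term≡rⁿ+sⁿ r s rs≡1 r+s≡w+2 (suc (suc n)) (suc N) (s≤s n+1≤N) = begin
    -- The recurrence is solved for its leading sum `S₂`.
    S₂                                          ≡⟨ solve 2 (λ a b → a := (a :+ b) :- b) refl S₂ S₀ ⟩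
    (S₂ + S₀) - S₀                              ≡⟨ cong (_- S₀) (∑-term-rec n N) ⟩
    (w * T + fromℕ 2 * S₁) - S₀
      ≡⟨ cong₂ (λ x y → (w * x + fromℕ 2 * y) - S₀)
           (∑-term≡rⁿ+sⁿ r s rs≡1 r+s≡w+2 (suc n) N n+1≤N)
           (∑-term≡rⁿ+sⁿ r s rs≡1 r+s≡w+2 (suc n) (suc N) (ℕ.m≤n⇒m≤1+n n+1≤N)) ⟩
    (w * (r * R + s * S) + fromℕ 2 * (r * R + s * S)) - S₀
      ≡⟨ cong₂ _-_ (sym (ℚ.*-distribʳ-+ (r * R + s * S) w (fromℕ 2)))
           (∑-term≡rⁿ+sⁿ r s rs≡1 r+s≡w+2 n (suc N) (ℕ.m≤n⇒m≤1+n (ℕ.<⇒≤ n+1≤N))) ⟩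
    (w + fromℕ 2) * (r * R + s * S) - (R + S)
      -- With w + 2 = r + s and 1 = rs, the recurrence becomes the one whose characteristic roots
      -- are r and s.
      ≡⟨ cong₂ (λ x y → x * (r * R + s * S) - y) (sym r+s≡w+2)
           (trans (sym (ℚ.*-identityˡ (R + S))) (cong (_* (R + S)) (sym rs≡1))) ⟩
    (r + s) * (r * R + s * S) - (r * s) * (R + S)
      ≡⟨ solve 4 (λ r s R S → (r :+ s) :* (r :* R :+ s :* S) :- (r :* s) :* (R :+ S) :=
                              r :* (r :* R) :+ s :* (s :* S)) refl r s R S ⟩
    r * (r * R) + s * (s * S)                   ∎
    where
    S₂ = ∑[ k ≤ suc N ] term (2 ℕ.+ n) k
    S₁ = ∑[ k ≤ suc N ] term (1 ℕ.+ n) k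
    S₀ = ∑[ k ≤ suc N ] term n k
    T  = ∑[ k ≤ N ] term (1 ℕ.+ n) k
    R  = r ^ n
    S  = s ^ n

-- Quotients, powers and signs

÷-unique : ∀ {x} z y .{{_ : ℚ.NonZero y}} → x ≡ z * y → x ÷ y ≡ z
÷-unique {x} z y x≡zy = begin
  x * 1/ y          ≡⟨ cong (_* 1/ y) x≡zy ⟩
  (z * y) * 1/ y    ≡⟨ ℚ.*-assoc z y (1/ y) ⟩
  z * (y * 1/ y)    ≡⟨ cong (z *_) (ℚ.*-inverseʳ y) ⟩
  z * 1ℚ            ≡⟨ ℚ.*-identityʳ z ⟩
  z                 ∎

x^2n≡[x*x]^n : ∀ x n → x ^ (2 ℕ.* n) ≡ (x * x) ^ n
x^2n≡[x*x]^n x n = begin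
  x ^ (2 ℕ.* n)      ≡⟨ ^-assocʳ x 2 n ⟨
  (x * (x * 1ℚ)) ^ n ≡⟨ cong (λ y → (x * y) ^ n) (ℚ.*-identityʳ x) ⟩
  (x * x) ^ n        ∎

x^4n≡[x*x]^n*[x*x]^n : ∀ x n → x ^ (4 ℕ.* n) ≡ (x * x) ^ n * (x * x) ^ n
x^4n≡[x*x]^n*[x*x]^n x n = begin
  x ^ (4 ℕ.* n)                ≡⟨ ^-assocʳ x 4 n ⟨
  (x * (x * (x * (x * 1ℚ)))) ^ n
    ≡⟨ cong (_^ n) (solve 1 (λ x → x :* (x :* (x :* (x :* con 1ℚ))) := (x :* x) :* (x :* x)) refl x) ⟩
  ((x * x) * (x * x)) ^ n      ≡⟨ ^-distrib-* (x * x) (x * x) n ⟩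
  (x * x) ^ n * (x * x) ^ n    ∎
  where open +-*-Solver

u*y≡x⇒[u*u]^n*[y*y]^n≡[x*x]^n : ∀ u y n {x} → u * y ≡ x → (u * u) ^ n * (y * y) ^ n ≡ (x * x) ^ n
u*y≡x⇒[u*u]^n*[y*y]^n≡[x*x]^n u y n {x} uy≡x = begin
  (u * u) ^ n * (y * y) ^ n     ≡⟨ ^-distrib-* (u * u) (y * y) n ⟨
  ((u * u) * (y * y)) ^ n
    ≡⟨ cong (_^ n) (solve 2 (λ u y → (u :* u) :* (y :* y) := (u :* y) :* (u :* y)) refl u y) ⟩
  ((u * y) * (u * y)) ^ n       ≡⟨ cong (λ v → (v * v) ^ n) uy≡x ⟩
  (x * x) ^ n                   ∎
  where open +-*-Solver

x*x≡1⇒x^n*x^n≡1 : ∀ {x} → x * x ≡ 1ℚ → ∀ n → x ^ n * x ^ n ≡ 1ℚ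
x*x≡1⇒x^n*x^n≡1 xx≡1 zero    = refl
x*x≡1⇒x^n*x^n≡1 {x} xx≡1 (suc n) = begin
  (x * x ^ n) * (x * x ^ n)
    ≡⟨ solve 2 (λ x y → (x :* y) :* (x :* y) := (x :* x) :* (y :* y)) refl x (x ^ n) ⟩
  (x * x) * (x ^ n * x ^ n)   ≡⟨ cong₂ _*_ xx≡1 (x*x≡1⇒x^n*x^n≡1 xx≡1 n) ⟩
  1ℚ                          ∎
  where open +-*-Solver

-- Since x^k is its own inverse, multiplying by it lowers the exponent.
x*x≡1⇒x^n*x^k≡x^[n∸k] : ∀ {x} → x * x ≡ 1ℚ → ∀ {n k} → k ℕ.≤ n → x ^ n * x ^ k ≡ x ^ (n ℕ.∸ k)
x*x≡1⇒x^n*x^k≡x^[n∸k] {x} xx≡1 {n} {k} k≤n = begin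
  x ^ n * x ^ k                       ≡⟨ cong (λ m → x ^ m * x ^ k) (ℕ.m∸n+n≡m k≤n) ⟨
  x ^ (n ℕ.∸ k ℕ.+ k) * x ^ k         ≡⟨ cong (_* x ^ k) (^-homo-* x (n ℕ.∸ k) k) ⟩
  (x ^ (n ℕ.∸ k) * x ^ k) * x ^ k     ≡⟨ ℚ.*-assoc (x ^ (n ℕ.∸ k)) (x ^ k) (x ^ k) ⟩
  x ^ (n ℕ.∸ k) * (x ^ k * x ^ k)     ≡⟨ cong (x ^ (n ℕ.∸ k) *_) (x*x≡1⇒x^n*x^n≡1 xx≡1 k) ⟩
  x ^ (n ℕ.∸ k) * 1ℚ                  ≡⟨ ℚ.*-identityʳ (x ^ (n ℕ.∸ k)) ⟩
  x ^ (n ℕ.∸ k)                       ∎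

-- The sign separates into a factor constant in `k` and a k-th power that can be merged with the
-- power of z.
sgn-*-∸ : ∀ i {n k} → k ℕ.≤ n → sgn (i ℤ.* (+ n ℤ.- + k)) ≡ sgn i ^ n * sgn i ^ k
sgn-*-∸ i {n} {k} k≤n = begin
  sgn (i ℤ.* (+ n ℤ.- + k))  ≡⟨ cong (λ m → sgn (i ℤ.* m)) (trans (ℤ.m-n≡m⊖n n k) (ℤ.⊖-≥ k≤n)) ⟩
  sgn (i ℤ.* + (n ℕ.∸ k))    ≡⟨ sgn-* i (n ℕ.∸ k) ⟩
  sgn i ^ (n ℕ.∸ k)          ≡⟨ x*x≡1⇒x^n*x^k≡x^[n∸k] (sgn*sgn≡1 i) k≤n ⟨
  sgn i ^ n * sgn i ^ k      ∎

-- Evaluation of the sum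

2*∑≡aa^n+bb^n : ∀ n i a b z → a * b ≡ 1ℚ → z ≡ a - sgn i * b →
  fromℕ 2 * ∑[ k ≤ n ] (sgn (i ℤ.* (+ n ℤ.- + k)) * coeff n k * z ^ (2 ℕ.* k)) ≡
  (a * a) ^ n + (b * b) ^ n
2*∑≡aa^n+bb^n n i a b z ab≡1 z≡a-εb = begin
  fromℕ 2 * ∑[ k ≤ n ] f k                    ≡⟨ ∑-*ˡ n (fromℕ 2) f ⟨
  -- In each summand ε^k and z^{2k} combine into w^k, and ε^n stays in front.
  ∑[ k ≤ n ] (fromℕ 2 * f k)                  ≡⟨ ∑-cong n 2f≡εⁿterm ⟩
  ∑[ k ≤ n ] (ε ^ n * term w n k)               ≡⟨ ∑-*ˡ n (ε ^ n) (term w n) ⟩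
  ε ^ n * ∑[ k ≤ n ] term w n k
    ≡⟨ cong (ε ^ n *_) (∑-term≡rⁿ+sⁿ w r s rs≡1 r+s≡w+2 n n ℕ.≤-refl) ⟩
  ε ^ n * (r ^ n + s ^ n)                     ≡⟨ ℚ.*-distribˡ-+ (ε ^ n) (r ^ n) (s ^ n) ⟩
  -- The powers of r and s each supply a second ε^n, which cancels the first.
  ε ^ n * r ^ n + ε ^ n * s ^ n               ≡⟨ cong₂ _+_ (unsign (a * a)) (unsign (b * b)) ⟩
  (a * a) ^ n + (b * b) ^ n                   ∎
  where
  open +-*-Solver
  ε = sgn i
  w = ε * (z * z)
  r = ε * (a * a)
  s = ε * (b * b)
  εε≡1 = sgn*sgn≡1 i

  f : ℕ → ℚ
  f k = sgn (i ℤ.* (+ n ℤ.- + k)) * coeff n k * z ^ (2 ℕ.* k)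

  2f≡εⁿterm : ∀ k → k ℕ.≤ n → fromℕ 2 * f k ≡ ε ^ n * term w n k
  2f≡εⁿterm k k≤n = begin
    fromℕ 2 * (sgn (i ℤ.* (+ n ℤ.- + k)) * coeff n k * z ^ (2 ℕ.* k))
      ≡⟨ cong₂ (λ x y → fromℕ 2 * (x * coeff n k * y)) (sgn-*-∸ i k≤n) (x^2n≡[x*x]^n z k) ⟩
    fromℕ 2 * ((ε ^ n * ε ^ k) * coeff n k * (z * z) ^ k)
      ≡⟨ solve 5 (λ t x y c u → t :* ((x :* y) :* c :* u) := x :* ((t :* c) :* (y :* u)))
           refl (fromℕ 2) (ε ^ n) (ε ^ k) (coeff n k) ((z * z) ^ k) ⟩
    ε ^ n * ((fromℕ 2 * coeff n k) * (ε ^ k * (z * z) ^ k))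
      ≡⟨ cong₂ (λ x y → ε ^ n * (x * y)) (2*coeff≡coeff₂ n k k≤n) (sym (^-distrib-* ε (z * z) k)) ⟩
    ε ^ n * (fromℕ (coeff₂ n k) * w ^ k) ∎

  rs≡1 : r * s ≡ 1ℚ
  rs≡1 = begin
    (ε * (a * a)) * (ε * (b * b))
      ≡⟨ solve 3 (λ e a b → (e :* (a :* a)) :* (e :* (b :* b)) := (e :* e) :* ((a :* b) :* (a :* b))) refl ε a b ⟩
    (ε * ε) * ((a * b) * (a * b))    ≡⟨ cong₂ (λ x y → x * (y * y)) εε≡1 ab≡1 ⟩
    1ℚ                               ∎

  r+s≡w+2 : r + s ≡ w + fromℕ 2
  r+s≡w+2 = begin
    ε * (a * a) + ε * (b * b)
      -- A 2 is subtracted and added, and factors 1 are inserted. Replacing these by ε² and ab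
      -- yields the expansion of ε(a - εb)².
      ≡⟨ solve 3 (λ e a b → e :* (a :* a) :+ e :* (b :* b) :=
           (e :* (a :* a) :- con (fromℕ 2) :* (con 1ℚ :* con 1ℚ) :+ (con 1ℚ :* e) :* (b :* b)) :+ con (fromℕ 2)) refl ε a b ⟩
    (ε * (a * a) - fromℕ 2 * (1ℚ * 1ℚ) + (1ℚ * ε) * (b * b)) + fromℕ 2
      ≡⟨ cong₂ (λ x y → (ε * (a * a) - fromℕ 2 * (x * y) + (x * ε) * (b * b)) + fromℕ 2) (sym εε≡1) (sym ab≡1) ⟩
    (ε * (a * a) - fromℕ 2 * ((ε * ε) * (a * b)) + ((ε * ε) * ε) * (b * b)) + fromℕ 2
      ≡⟨ solve 3 (λ e a b →
           (e :* (a :* a) :- con (fromℕ 2) :* ((e :* e) :* (a :* b)) :+ ((e :* e) :* e) :* (b :* b)) :+ con (fromℕ 2) :=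
           e :* ((a :- e :* b) :* (a :- e :* b)) :+ con (fromℕ 2)) refl ε a b ⟩
    ε * ((a - ε * b) * (a - ε * b)) + fromℕ 2
      ≡⟨ cong (λ y → ε * (y * y) + fromℕ 2) z≡a-εb ⟨
    ε * (z * z) + fromℕ 2 ∎

  unsign : ∀ x → ε ^ n * (ε * x) ^ n ≡ x ^ n
  unsign x = begin
    ε ^ n * (ε * x) ^ n      ≡⟨ cong (ε ^ n *_) (^-distrib-* ε x n) ⟩
    ε ^ n * (ε ^ n * x ^ n)  ≡⟨ ℚ.*-assoc (ε ^ n) (ε ^ n) (x ^ n) ⟨
    (ε ^ n * ε ^ n) * x ^ n  ≡⟨ cong (_* x ^ n) (x*x≡1⇒x^n*x^n≡1 εε≡1 n) ⟩
    1ℚ * x ^ n               ≡⟨ ℚ.*-identityˡ (x ^ n) ⟩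
    x ^ n                    ∎

theorem12 : ∀ (n : ℕ) (p q : ℤ) .{{_ : ℤ.NonZero p}} .{{_ : ℤ.NonZero q}} →
    let instance
          FpFq≢0 = FpFq-nonZero p q
          2FqFp≢0 = 2FqFp-nonZero n p q
    in
    ∑[ k ≤ n ]
      ( ((- 1ℚ) ^ℤ ((p ℤ.- q) ℤ.* (+ n ℤ.- + k)))
      * coeff n k
      * ((Fℚ (p ℤ.+ q) * Fℚ (p ℤ.- q)) ÷ (Fℚ p * Fℚ q)) ^ (2 ℕ.* k) )
    ≡ (Fℚ p ^ (4 ℕ.* n) + Fℚ q ^ (4 ℕ.* n))
      ÷ (fromℤ (+ 2) * Fℚ q ^ (2 ℕ.* n) * Fℚ p ^ (2 ℕ.* n))
theorem12 n p q = sym (÷-unique L (fromℤ (+ 2) * B ^ (2 ℕ.* n) * A ^ (2 ℕ.* n)) {{2FqFp-nonZero n p q}} (begin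
  A ^ (4 ℕ.* n) + B ^ (4 ℕ.* n)
    ≡⟨ cong₂ _+_ (x^4n≡[x*x]^n*[x*x]^n A n) (x^4n≡[x*x]^n*[x*x]^n B n) ⟩
  P * P + Q * Q
    -- One factor of each square is rewritten, P as U·Q and Q as V·P, so that both products contain
    -- Q·P.
    ≡⟨ cong₂ (λ x y → x * P + y * Q)
         (u*y≡x⇒[u*u]^n*[y*y]^n≡[x*x]^n a B n aB≡A)
         (u*y≡x⇒[u*u]^n*[y*y]^n≡[x*x]^n b A n bA≡B) ⟨
  (U * Q) * P + (V * P) * Q
    ≡⟨ solve 4 (λ U V P Q → (U :* Q) :* P :+ (V :* P) :* Q := (U :+ V) :* (Q :* P)) refl U V P Q ⟩
  (U + V) * (Q * P)
    ≡⟨ cong (_* (Q * P)) (2*∑≡aa^n+bb^n n (p ℤ.- q) a b z ab≡1 z≡a-εb) ⟨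
  (fromℕ 2 * L) * (Q * P)
    ≡⟨ solve 4 (λ t L Q P → (t :* L) :* (Q :* P) := L :* (t :* Q :* P)) refl (fromℕ 2) L Q P ⟩
  L * (fromℕ 2 * Q * P)
    ≡⟨ cong₂ (λ x y → L * (fromℕ 2 * x * y)) (x^2n≡[x*x]^n B n) (x^2n≡[x*x]^n A n) ⟨
  L * (fromℕ 2 * B ^ (2 ℕ.* n) * A ^ (2 ℕ.* n)) ∎))
  where
  open +-*-Solver
  A = Fℚ p
  B = Fℚ q
  ε = sgn (p ℤ.- q)
  instance
    A≢0 : ℚ.NonZero A
    A≢0 = Fℚ-nonZero p
    B≢0 : ℚ.NonZero B
    B≢0 = Fℚ-nonZero q
    AB≢0 : ℚ.NonZero (A * B)
    AB≢0 = FpFq-nonZero p q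
  a = A ÷ B
  b = B ÷ A
  z = (Fℚ (p ℤ.+ q) * Fℚ (p ℤ.- q)) ÷ (A * B)
  L = ∑[ k ≤ n ] (sgn ((p ℤ.- q) ℤ.* (+ n ℤ.- + k)) * coeff n k * z ^ (2 ℕ.* k))
  P = (A * A) ^ n
  Q = (B * B) ^ n
  U = (a * a) ^ n
  V = (b * b) ^ n

  x÷y*y≡x : ∀ x y .{{_ : ℚ.NonZero y}} → (x ÷ y) * y ≡ x
  x÷y*y≡x x y = trans (ℚ.*-assoc x (1/ y) y)
    (trans (cong (x *_) (ℚ.*-inverseˡ y)) (ℚ.*-identityʳ x))

  aB≡A : a * B ≡ A
  aB≡A = x÷y*y≡x A B

  bA≡B : b * A ≡ B
  bA≡B = x÷y*y≡x B A

  ab≡1 : a * b ≡ 1ℚ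
  ab≡1 = begin
    a * (B * 1/ A)   ≡⟨ ℚ.*-assoc a B (1/ A) ⟨
    (a * B) * 1/ A   ≡⟨ cong (_* 1/ A) aB≡A ⟩
    A * 1/ A         ≡⟨ ℚ.*-inverseʳ A ⟩
    1ℚ               ∎

  z≡a-εb : z ≡ a - ε * b
  z≡a-εb = ÷-unique (a - ε * b) (A * B) (begin
    Fℚ (p ℤ.+ q) * Fℚ (p ℤ.- q)         ≡⟨ catalan p q ⟩
    A * A - ε * (B * B)
      -- Writing one A as aB and one B as bA exhibits the common factor AB.
      ≡⟨ cong₂ (λ x y → A * x - ε * (B * y)) aB≡A bA≡B ⟨
    A * (a * B) - ε * (B * (b * A))
      ≡⟨ solve 5 (λ A B e a b → A :* (a :* B) :- e :* (B :* (b :* A)) := (a :- e :* b) :* (A :* B))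
           refl A B ε a b ⟩
    (a - ε * b) * (A * B)               ∎)
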